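{- Any flip process has at least one fixed point: for every $k\in\mathbb{N}$ and every rule $\mathcal{R}$ of order $k$ there exists a graphon $W\in\mathcal{W}_0$ with $\mathfrak{V}_{\mathcal{R}}W=0$ (equivalently, whose trajectory satisfies $\Phi^tW=W$ for all $t$).
   Context: $(\Omega,\pi)$ is a fixed atomless probability space whose sigma-algebra is separable (there is a countable family $\mathcal{C}$ of measurable sets such that for every measurable $S$ and $\delta>0$ some $T\in\mathcal{C}$ has $\pi(S\ominus T)<\delta$). $\mathcal{W}$ is the Banach space of kernels: bounded measurable functions $W:\Omega^2\to\mathbb{R}$ with $W(x,y)=W(y,x)$ a.e., identified when equal a.e., with the $L^\infty$-norm $\|\cdot\|_\infty$. $\mathcal{W}_0\subset\mathcal{W}$ is the set of graphons: kernels with values in $[0,1]$ a.e. $\mathcal{H}_k$ is the set of all (simple, labelled) graphs on vertex set $[k]$. A rule of order $k$ (defining a flip process) is a matrix $\mathcal{R}\in[0,1]^{\mathcal{H}_k\times\mathcal{H}_k}$ with $\sum_{J}\mathcal{R}_{H,J}=1$ for every $H\in\mathcal{H}_k$. For $F\in\mathcal{H}_k$, distinct $a,b\in[k]$ and $W\in\mathcal{W}$ define $$(T_F^{a,b}W)(x,y)=\int\prod_{ij\in E(F)}W(x_i,x_j)\prod_{ij\notin E(F)}(1-W(x_i,x_j))\prod_{i\in[k]\setminus\{a,b\}}\pi(\mathrm{d}x_i),\quad x_a=x,\ x_b=y,$$ where $ij$ ranges over unordered pairs of distinct elements of $[k]$. The velocity operator is $$\mathfrak{V}_{\mathcal{R}}W=\sum_{F,H\in\mathcal{H}_k}\mathcal{R}_{F,H}\sum_{1\le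 a\ne b\le k}T_F^{a,b}W\cdot\left(\mathbb{I}_{\{ab\in E(H)\setminus E(F)\}}-\mathbb{I}_{\{ab\in E(F)\setminus E(H)\}}\right),$$ the inner sum being over ordered pairs. The trajectory $t\mapsto\Phi^tW$ of a graphon $W$ is the unique maximal solution of $\frac{\mathrm{d}}{\mathrm{d}t}\Phi^tW=\mathfrak{V}_{\mathcal{R}}\Phi^tW$, $\Phi^0W=W$ (derivative with respect to $\|\cdot\|_\infty$). A fixed point is a graphon at which the trajectory stays constant. -}

module Defs where

open import Algebra.Bundles using (CommutativeRing)
import Algebra.Properties.Monoid.Sum as MonoidSum
open import Axiom.ExcludedMiddle using (ExcludedMiddle)
open import Data.Bool.Base using (Bool; true; false; not; _∧_; if_then_else_)
open import Data.Bool.Properties using (T?)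
open import Data.Fin.Base using (Fin; zero; suc; toℕ)
open import Data.Fin.Properties using (_≟_; _<?_)
open import Data.List.Base
  using (List; []; _∷_; [_]; map; foldr; filter; allFin; cartesianProduct; cartesianProductWith)
open import Data.Nat.Base as ℕ using (ℕ; zero; suc)
open import Data.Product.Base using (Σ-syntax; ∃; ∃-syntax; _×_; _,_; proj₁; uncurry)
open import Data.Sum.Base as Sum using ()
open import Data.Unit.Base using (⊤; tt)
open import Data.Vec.Base as Vec using (Vec)
open import Data.Vec.Functional using (updateAt)
open import Function.Base using (_∘_; const)
open import Level using (0ℓ) renaming (suc to lsuc)
open import Relation.Binary.Construct.NonStrictToStrict as Strict using ()
open import Relation.Binary.PropositionalEquality.Core using (_≢_)
open import Relation.Binary.Structures using (IsTotalOrder)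
open import Relation.Nullary.Decidable using (yes; no; does; ¬?; _×-dec_)
open import Relation.Nullary.Negation.Core using (¬_)
open import Relation.Unary
  using (Pred; _∈_; _∉_; _⊆_; _≐_; ∅; U; ∁; ⋃; _∪_; _∖_; _⊥_; _⟨×⟩_)

-- The real numbers, given axiomatically: a Dedekind-complete ordered field is
-- determined up to unique isomorphism.  Completeness is required for
-- predicates in Set₁ because the lower Lebesgue sums below quantify over
-- measurable sets, which live in Set₁.

record CompleteOrderedField : Set₂ where
  field
    commutativeRing : CommutativeRing 0ℓ 0ℓ
  open CommutativeRing commutativeRing public renaming (Carrier to ℝ)

  infix 4 _≤_
  field
    _≤_          : ℝ → ℝ → Set
    isTotalOrder : IsTotalOrder _≈_ _≤_
    +-monoʳ-≤    : ∀ z {x y} → x ≤ y → z + x ≤ z + y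
    *-nonneg     : ∀ {x y} → 0# ≤ x → 0# ≤ y → 0# ≤ x * y
    0≉1          : ¬ 0# ≈ 1#
    inverse      : ∀ x → ¬ x ≈ 0# → ∃[ y ] x * y ≈ 1#

  IsUpperBound : Pred ℝ (lsuc 0ℓ) → ℝ → Set₁
  IsUpperBound P b = ∀ x → P x → x ≤ b

  IsSupremum : Pred ℝ (lsuc 0ℓ) → ℝ → Set₁
  IsSupremum P s = IsUpperBound P s × (∀ b → IsUpperBound P b → s ≤ b)

  field
    complete : ∀ P → ∃ P → ∃ (IsUpperBound P) → ∃ (IsSupremum P)

  open Strict _≈_ _≤_ public using (_<_)
  open IsTotalOrder isTotalOrder public using (total)
  open MonoidSum +-monoid public using (sum)

  ∣_∣ : ℝ → ℝ
  ∣ x ∣ = Sum.[ const x , const (- x) ]′ (total 0# x)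

  HasSum : (ℕ → ℝ) → ℝ → Set
  HasSum a s = ∀ ε → 0# < ε → ∃[ N ] ∀ n → N ℕ.≤ n →
    ∣ sum {n} (a ∘ toℕ) - s ∣ < ε

  ∑ : {A : Set} → List A → (A → ℝ) → ℝ
  ∑ xs f = foldr _+_ 0# (map f xs)

  ∏ : {A : Set} → List A → (A → ℝ) → ℝ
  ∏ xs f = foldr _*_ 1# (map f xs)

  𝕀 : Bool → ℝ
  𝕀 b = if b then 1# else 0#

-- The measure π is a total function on subsets, but only its values on
-- measurable sets are constrained or used.

record ProbabilitySpace (𝔽 : CompleteOrderedField) : Set₂ where
  open CompleteOrderedField 𝔽
  field
    Ω                : Set
    Measurable       : Pred (Pred Ω 0ℓ) (lsuc 0ℓ)
    measurable-resp  : ∀ {A B} → A ≐ B → Measurable A → Measurable B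
    measurable-U     : Measurable U
    measurable-∁     : ∀ {A} → Measurable A → Measurable (∁ A)
    measurable-⋃     : (A : ℕ → Pred Ω 0ℓ) → (∀ n → Measurable (A n)) → Measurable (⋃ ℕ A)
    π                : Pred Ω 0ℓ → ℝ
    π-cong           : ∀ {A B} → Measurable A → A ≐ B → π A ≈ π B
    π-nonneg         : ∀ {A} → Measurable A → 0# ≤ π A
    π-∅              : π ∅ ≈ 0#
    π-⋃              : (A : ℕ → Pred Ω 0ℓ) → (∀ n → Measurable (A n)) →
                       (∀ m n → m ≢ n → A m ⊥ A n) → HasSum (π ∘ A) (π (⋃ ℕ A))
    π-U              : π U ≈ 1#

  Atomless : Set₁
  Atomless = ∀ A → Measurable A → 0# < π A →
    Σ[ B ∈ Pred Ω 0ℓ ] Measurable B × B ⊆ A × 0# < π B × π B < π A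

  Separable : Set₁
  Separable = Σ[ C ∈ (ℕ → Pred Ω 0ℓ) ] (∀ n → Measurable (C n)) ×
    (∀ S → Measurable S → ∀ δ → 0# < δ → ∃[ n ] π ((S ∖ C n) ∪ (C n ∖ S)) < δ)

  data Measurable² : Pred (Pred (Ω × Ω) 0ℓ) (lsuc 0ℓ) where
    rectangle  : ∀ {A B} → Measurable A → Measurable B → Measurable² (A ⟨×⟩ B)
    complement : ∀ {E} → Measurable² E → Measurable² (∁ E)
    union      : (E : ℕ → Pred (Ω × Ω) 0ℓ) → (∀ n → Measurable² (E n)) → Measurable² (⋃ ℕ E)
    resp       : ∀ {E E′} → E ≐ E′ → Measurable² E → Measurable² E′

-- A simple graph on the vertex set Fin k.  An element of Graph (suc k) lists
-- the neighbours of vertex 0 among the other k vertices, followed by the graph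
-- these span; thus each unordered pair of distinct vertices carries exactly
-- one Boolean, and there are no loops.

Graph : ℕ → Set
Graph zero    = ⊤
Graph (suc k) = Vec Bool k × Graph k

edge : ∀ {k} → Graph k → Fin k → Fin k → Bool
edge {suc k} (v , G) zero    zero    = false
edge {suc k} (v , G) zero    (suc j) = Vec.lookup v j
edge {suc k} (v , G) (suc i) zero    = Vec.lookup v i
edge {suc k} (v , G) (suc i) (suc j) = edge G i j

bitVectors : ∀ n → List (Vec Bool n)
bitVectors zero    = [ Vec.[] ]
bitVectors (suc n) = cartesianProductWith Vec._∷_ (true ∷ false ∷ []) (bitVectors n)

allGraphs : ∀ k → List (Graph k)
allGraphs zero    = [ tt ]
allGraphs (suc k) = cartesianProduct (bitVectors k) (allGraphs k)

allPairs : ∀ k → List (Fin k × Fin k)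
allPairs k = cartesianProduct (allFin k) (allFin k)

-- An unordered pair of distinct vertices is represented by (i , j) with i < j.
unorderedPairs : ∀ k → List (Fin k × Fin k)
unorderedPairs k = filter (uncurry _<?_) (allPairs k)

orderedPairs : ∀ k → List (Fin k × Fin k)
orderedPairs k = filter (λ (a , b) → ¬? (a ≟ b)) (allPairs k)

edges nonEdges : ∀ {k} → Graph k → List (Fin k × Fin k)
edges    {k} F = filter (λ (i , j) → T? (edge F i j)) (unorderedPairs k)
nonEdges {k} F = filter (λ (i , j) → T? (not (edge F i j))) (unorderedPairs k)

-- Analysis is done classically; excluded middle makes suprema and indicator
-- functions total.

module FlipProcess (em : ∀ {ℓ} → ExcludedMiddle ℓ)
                   (𝔽 : CompleteOrderedField)
                   (P : ProbabilitySpace 𝔽) where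
  open CompleteOrderedField 𝔽 public
  open ProbabilitySpace P public

  -- The least upper bound of a nonempty bounded-above set, and 0 otherwise.
  sup : Pred ℝ (lsuc 0ℓ) → ℝ
  sup S with em {P = ∃ S × ∃ (IsUpperBound S)}
  ... | yes (ne , bd) = proj₁ (complete S ne bd)
  ... | no _          = 0#

  record LowerSum (f : Ω → ℝ) (r : ℝ) : Set₁ where
    field
      size       : ℕ
      part       : Fin size → Pred Ω 0ℓ
      measurable : ∀ i → Measurable (part i)
      disjoint   : ∀ i j → i ≢ j → part i ⊥ part j
      covering   : ∀ ω → ∃[ i ] ω ∈ part i
      value      : Fin size → ℝ
      below      : ∀ i ω → ω ∈ part i → value i ≤ f ω
      total-sum  : r ≈ sum (λ i → value i * π (part i))

  -- The Lebesgue integral of a bounded measurable function, as the supremum of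
  -- the integrals of the simple functions below it.
  ∫ : (Ω → ℝ) → ℝ
  ∫ f = sup (LowerSum f)

  -- Integral against the product measure over the listed coordinates, written
  -- as an iterated integral; the remaining coordinates are kept fixed.
  ∫over : ∀ {k} → List (Fin k) → ((Fin k → Ω) → ℝ) → (Fin k → Ω) → ℝ
  ∫over []       g x = g x
  ∫over (i ∷ is) g x = ∫ (λ ω → ∫over is g (updateAt x i (const ω)))

  𝟙 : {A : Set} → Pred A 0ℓ → A → ℝ
  𝟙 E z = 𝕀 (does (em {P = z ∈ E}))

  π² : Pred (Ω × Ω) 0ℓ → ℝ
  π² E = ∫ (λ x → ∫ (λ y → 𝟙 E (x , y)))

  AlmostEverywhere : (Ω → Ω → Set) → Set₁
  AlmostEverywhere Q = Σ[ N ∈ Pred (Ω × Ω) 0ℓ ] Measurable² N × π² N ≈ 0# ×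
    (∀ x y → (x , y) ∉ N → Q x y)

  infix 4 _≈ᵃᵉ_
  _≈ᵃᵉ_ : (f g : Ω → Ω → ℝ) → Set₁
  f ≈ᵃᵉ g = AlmostEverywhere λ x y → f x y ≈ g x y

  -- ‖ f ‖∞≤ c says that the essential supremum of ∣ f ∣ is at most c.
  ‖_‖∞≤_ : (Ω → Ω → ℝ) → ℝ → Set₁
  ‖ f ‖∞≤ c = AlmostEverywhere λ x y → ∣ f x y ∣ ≤ c

  record Kernel : Set₁ where
    field
      fun        : Ω → Ω → ℝ
      measurable : ∀ c → Measurable² (λ (x , y) → c < fun x y)
      bounded    : ∃[ M ] ∀ x y → ∣ fun x y ∣ ≤ M
      symmetric  : AlmostEverywhere λ x y → fun x y ≈ fun y x
  open Kernel public using (fun)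

  IsGraphon : Kernel → Set₁
  IsGraphon W = AlmostEverywhere λ x y → 0# ≤ fun W x y × fun W x y ≤ 1#

  record Rule (k : ℕ) : Set where
    field
      prob     : Graph k → Graph k → ℝ
      nonneg   : ∀ H J → 0# ≤ prob H J
      atMost1  : ∀ H J → prob H J ≤ 1#
      row-sum  : ∀ H → ∑ (allGraphs k) (λ J → prob H J) ≈ 1#
  open Rule public using (prob)

  -- The initial assignment puts x at a and y everywhere else; the values away
  -- from a and b are then overwritten by the integration variables.
  T^ : ∀ {k} → Graph k → Fin k → Fin k → Kernel → Ω → Ω → ℝ
  T^ {k} F a b W x y =
    ∫over (filter (λ i → ¬? (i ≟ a) ×-dec ¬? (i ≟ b)) (allFin k))
      (λ z → ∏ (edges F) (λ (i , j) → fun W (z i) (z j))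
           * ∏ (nonEdges F) (λ (i , j) → 1# - fun W (z i) (z j)))
      (λ i → if does (i ≟ a) then x else y)

  𝔙 : ∀ {k} → Rule k → Kernel → Ω → Ω → ℝ
  𝔙 {k} R W x y =
    ∑ (allGraphs k) λ F → ∑ (allGraphs k) λ H → prob R F H *
      ∑ (orderedPairs k) λ (a , b) → T^ F a b W x y *
        (𝕀 (edge H a b ∧ not (edge F a b)) - 𝕀 (edge F a b ∧ not (edge H a b)))

  -- Curves of kernels are total functions on ℝ of which only the restriction
  -- to the domain D matters.

  HasDerivative : Pred ℝ 0ℓ → (ℝ → Kernel) → ℝ → (Ω → Ω → ℝ) → Set₁
  HasDerivative D Φ t g = ∀ ε → 0# < ε → ∃[ δ ] 0# < δ × (∀ h → ∣ h ∣ < δ → D (t + h) →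
    ‖ (λ x y → fun (Φ (t + h)) x y - fun (Φ t) x y - h * g x y) ‖∞≤ (ε * ∣ h ∣))

  record IsSolution {k} (R : Rule k) (W : Kernel) (D : Pred ℝ 0ℓ) (Φ : ℝ → Kernel) : Set₁ where
    field
      zero∈D   : 0# ∈ D
      convex   : ∀ {r s t} → r ∈ D → t ∈ D → r ≤ s → s ≤ t → s ∈ D
      open-D   : ∀ t → t ∈ D → ∃[ δ ] 0# < δ × (∀ s → ∣ s - t ∣ < δ → s ∈ D)
      cong     : ∀ {s t} → s ∈ D → t ∈ D → s ≈ t → fun (Φ s) ≈ᵃᵉ fun (Φ t)
      initial  : fun (Φ 0#) ≈ᵃᵉ fun W
      equation : ∀ t → t ∈ D → HasDerivative D Φ t (𝔙 R (Φ t))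

  -- The trajectory of W is its maximal solution, which is unique up to null
  -- sets, so that it can be referred to by this property.
  record IsTrajectory {k} (R : Rule k) (W : Kernel) (D : Pred ℝ 0ℓ) (Φ : ℝ → Kernel) : Set₁ where
    field
      isSolution : IsSolution R W D Φ
      maximal    : ∀ D′ Φ′ → IsSolution R W D′ Φ′ → D ⊆ D′ →
                   (∀ t → t ∈ D → fun (Φ′ t) ≈ᵃᵉ fun (Φ t)) → D′ ⊆ D

  IsFixedPoint : ∀ {k} → Rule k → Kernel → Set₁
  IsFixedPoint R W = IsGraphon W ×
    (∃[ Φ ] IsTrajectory R W U Φ × (∀ t → fun (Φ t) ≈ᵃᵉ fun W))

{-# OPTIONS --safe #-}

-- On a constant graphon with value p every T_F^{a,b} is again constant, so the
-- velocity there is a polynomial in p.  At p = 0 only the empty graph has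
-- positive density and edges can only be gained, at p = 1 only the complete
-- graph does and edges can only be lost; hence the polynomial is nonnegative at
-- 0 and nonpositive at 1, and it vanishes somewhere in between.

module Submission where

open import Defs
import Algebra.Properties.Ring as RingProperties
import Algebra.Properties.Semiring.Sum as SemiringSum
import Algebra.Solver.Ring.NaturalCoefficients.Default as SemiringSolver
open import Axiom.ExcludedMiddle using (ExcludedMiddle)
open import Data.Bool.Base using (Bool; true; false; not; _∧_; T)
open import Data.Bool.Properties using (T?)
open import Data.Empty using (⊥-elim)
open import Data.Fin.Base using (Fin; zero; suc; toℕ)
open import Data.Fin.Properties using (_≟_; _<?_; <-cmp)
open import Data.List.Base using (List; []; _∷_; allFin; filter)
open import Data.List.Membership.Propositional using () renaming (_∈_ to _∈ˡ_)
open import Data.List.Membership.Propositional.Properties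
  using (∈-filter⁺; ∈-filter⁻; ∈-cartesianProduct⁺; ∈-allFin)
open import Data.List.Relation.Unary.Any using (here; there)
open import Data.Nat.Base as ℕ using (ℕ; zero; suc)
open import Data.Nat.Properties using (m≤n+m)
open import Data.Product.Base
  using (∃; ∃-syntax; _×_; _,_; proj₁; proj₂; uncurry)
open import Data.Sum.Base using (_⊎_; inj₁; inj₂)
open import Data.Unit.Base using (tt)
open import Function.Base using (_∘_; const)
open import Level using (0ℓ; Lift; lift) renaming (suc to lsuc)
open import Relation.Binary.Bundles using (TotalOrder)
open import Relation.Binary.Definitions using (tri<; tri≈; tri>)
open import Relation.Binary.PropositionalEquality.Core as ≡ using (_≡_; _≢_)
import Relation.Binary.Reasoning.PartialOrder as PartialOrderReasoning
open import Relation.Nullary.Decidable using (yes; no; ¬?; _×-dec_)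
open import Relation.Nullary.Negation.Core using (¬_)
open import Relation.Unary using (Pred; _∈_; ∅; U; ∁; ⋃; _⊥_; _⟨×⟩_)

-- Edges and non-edges as lists of ordered index pairs.

edge-sym : ∀ {k} (F : Graph k) i j → edge F i j ≡ edge F j i
edge-sym {suc k} (v , F) zero    zero    = ≡.refl
edge-sym {suc k} (v , F) zero    (suc j) = ≡.refl
edge-sym {suc k} (v , F) (suc i) zero    = ≡.refl
edge-sym {suc k} (v , F) (suc i) (suc j) = edge-sym F i j

∈-allPairs : ∀ {k} (i j : Fin k) → (i , j) ∈ˡ allPairs k
∈-allPairs i j = ∈-cartesianProduct⁺ (∈-allFin i) (∈-allFin j)

∈-orderedPairs⁻ : ∀ {k} {a b : Fin k} → (a , b) ∈ˡ orderedPairs k → a ≢ b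
∈-orderedPairs⁻ {k} =
  proj₂ ∘ ∈-filter⁻ (λ (a , b) → ¬? (a ≟ b)) {xs = allPairs k}

∈-unorderedPairs : ∀ {k} {a b : Fin k} → a ≢ b →
                   (a , b) ∈ˡ unorderedPairs k ⊎ (b , a) ∈ˡ unorderedPairs k
∈-unorderedPairs {k} {a} {b} a≢b with <-cmp a b
... | tri< a<b _ _ = inj₁ (∈-filter⁺ (uncurry _<?_) (∈-allPairs a b) a<b)
... | tri≈ _ a≡b _ = ⊥-elim (a≢b a≡b)
... | tri> _ _ b<a = inj₂ (∈-filter⁺ (uncurry _<?_) (∈-allPairs b a) b<a)

-- Supplies the vanishing factor in the density at `0#`. The pair may be listed as `(b , a)`, in
-- which case `edge-sym` turns the hypothesis around.
edges-nonempty : ∀ {k} (F : Graph k) {a b} → a ≢ b → edge F a b ≡ true →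
                 ∃ (_∈ˡ edges F)
edges-nonempty F {a} {b} a≢b ab with ∈-unorderedPairs a≢b
... | inj₁ ab∈ = _ , ∈-filter⁺ (λ (i , j) → T? (edge F i j)) ab∈
  (≡.subst T (≡.sym ab) tt)
... | inj₂ ba∈ = _ , ∈-filter⁺ (λ (i , j) → T? (edge F i j)) ba∈
  (≡.subst T (≡.sym (≡.trans (edge-sym F b a) ab)) tt)

nonEdges-nonempty : ∀ {k} (F : Graph k) {a b} → a ≢ b → edge F a b ≡ false →
                    ∃ (_∈ˡ nonEdges F)
nonEdges-nonempty F {a} {b} a≢b ab with ∈-unorderedPairs a≢b
... | inj₁ ab∈ = _ , ∈-filter⁺ (λ (i , j) → T? (not (edge F i j))) ab∈
  (≡.subst (T ∘ not) (≡.sym ab) tt)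
... | inj₂ ba∈ = _ , ∈-filter⁺ (λ (i , j) → T? (not (edge F i j))) ba∈
  (≡.subst (T ∘ not) (≡.sym (≡.trans (edge-sym F b a) ab)) tt)

-- Arithmetic, order and absolute value in an ordered field.

module OrderedFieldProperties (𝔽 : CompleteOrderedField) where
  open CompleteOrderedField 𝔽
  open RingProperties ring using
    (-0#≈0#; -‿involutive; -‿distribˡ-*)
  open SemiringSolver commutativeSemiring using (solve; _:=_; _:+_; _:*_)

  totalOrder : TotalOrder 0ℓ 0ℓ 0ℓ
  totalOrder = record { isTotalOrder = isTotalOrder }

  open TotalOrder totalOrder public using (poset) renaming
    (refl to ≤-refl; reflexive to ≤-reflexive; trans to ≤-trans; antisym to ≤-antisym)
  open PartialOrderReasoning poset

  +-monoˡ-≤ : ∀ z {x y} → x ≤ y → x + z ≤ y + z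
  +-monoˡ-≤ z {x} {y} x≤y = begin
    x + z ≈⟨ +-comm x z ⟩
    z + x ≤⟨ +-monoʳ-≤ z x≤y ⟩
    z + y ≈⟨ +-comm z y ⟩
    y + z ∎

  +-mono-≤ : ∀ {x y u v} → x ≤ y → u ≤ v → x + u ≤ y + v
  +-mono-≤ {y = y} {u} x≤y u≤v = ≤-trans (+-monoˡ-≤ u x≤y) (+-monoʳ-≤ y u≤v)

  x+y-y≈x : ∀ x y → x + y - y ≈ x
  x+y-y≈x x y = trans (+-assoc x y (- y)) (trans (+-congˡ (-‿inverseʳ y)) (+-identityʳ x))

  +-cancelʳ-≤ : ∀ z {x y} → x + z ≤ y + z → x ≤ y
  +-cancelʳ-≤ z {x} {y} x+z≤y+z = begin
    x         ≈⟨ x+y-y≈x x z ⟨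
    x + z - z ≤⟨ +-monoˡ-≤ (- z) x+z≤y+z ⟩
    y + z - z ≈⟨ x+y-y≈x y z ⟩
    y         ∎

  x-y+y≈x : ∀ x y → x - y + y ≈ x
  x-y+y≈x x y = trans (+-assoc x (- y) y) (trans (+-congˡ (-‿inverseˡ y)) (+-identityʳ x))

  x+[y-x]≈y : ∀ x y → x + (y - x) ≈ y
  x+[y-x]≈y x y = trans (+-comm x (y - x)) (x-y+y≈x y x)

  x≤y⇒0≤y-x : ∀ {x y} → x ≤ y → 0# ≤ y - x
  x≤y⇒0≤y-x {x} {y} x≤y = begin
    0#    ≈⟨ -‿inverseʳ x ⟨
    x - x ≤⟨ +-monoˡ-≤ (- x) x≤y ⟩
    y - x ∎

  neg-antimono-≤ : ∀ {x y} → x ≤ y → - y ≤ - x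
  neg-antimono-≤ {x} {y} x≤y = +-cancelʳ-≤ y (begin
    - y + y ≈⟨ -‿inverseˡ y ⟩
    0#      ≈⟨ -‿inverseˡ x ⟨
    - x + x ≤⟨ +-monoʳ-≤ (- x) x≤y ⟩
    - x + y ∎)

  x≤0⇒0≤-x : ∀ {x} → x ≤ 0# → 0# ≤ - x
  x≤0⇒0≤-x x≤0 = ≤-trans (≤-reflexive (sym -0#≈0#)) (neg-antimono-≤ x≤0)

  0≤x⇒-x≤0 : ∀ {x} → 0# ≤ x → - x ≤ 0#
  0≤x⇒-x≤0 0≤x = ≤-trans (neg-antimono-≤ 0≤x) (≤-reflexive -0#≈0#)

  x≤x+y : ∀ {x y} → 0# ≤ y → x ≤ x + y
  x≤x+y {x} {y} 0≤y = ≤-trans (≤-reflexive (sym (+-identityʳ x))) (+-monoʳ-≤ x 0≤y)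

  +-nonneg : ∀ {x y} → 0# ≤ x → 0# ≤ y → 0# ≤ x + y
  +-nonneg 0≤x 0≤y = ≤-trans 0≤x (x≤x+y 0≤y)

  *-monoˡ-≤ : ∀ {x y z} → 0# ≤ z → x ≤ y → z * x ≤ z * y
  *-monoˡ-≤ {x} {y} {z} 0≤z x≤y = begin
    z * x               ≤⟨ x≤x+y (*-nonneg 0≤z (x≤y⇒0≤y-x x≤y)) ⟩
    z * x + z * (y - x) ≈⟨ distribˡ z x (y - x) ⟨
    z * (x + (y - x))   ≈⟨ *-congˡ (x+[y-x]≈y x y) ⟩
    z * y               ∎

  *-monoʳ-≤ : ∀ {x y z} → 0# ≤ z → x ≤ y → x * z ≤ y * z
  *-monoʳ-≤ {x} {y} {z} 0≤z x≤y = begin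
    x * z ≈⟨ *-comm x z ⟩
    z * x ≤⟨ *-monoˡ-≤ 0≤z x≤y ⟩
    z * y ≈⟨ *-comm z y ⟩
    y * z ∎

  *-nonpos : ∀ {x y} → 0# ≤ x → y ≤ 0# → x * y ≤ 0#
  *-nonpos {x} 0≤x y≤0 = ≤-trans (*-monoˡ-≤ 0≤x y≤0) (≤-reflexive (zeroʳ x))

  0≤1 : 0# ≤ 1#
  0≤1 with total 0# 1#
  ... | inj₁ 0≤1 = 0≤1
  ... | inj₂ 1≤0 = begin
    0#            ≤⟨ *-nonneg (x≤0⇒0≤-x 1≤0) (x≤0⇒0≤-x 1≤0) ⟩
    - 1# * - 1#   ≈⟨ -‿distribˡ-* 1# (- 1#) ⟨
    - (1# * - 1#) ≈⟨ -‿cong (*-identityˡ (- 1#)) ⟩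
    - - 1#        ≈⟨ -‿involutive 1# ⟩
    1#            ∎

  ¬1≤0 : ¬ 1# ≤ 0#
  ¬1≤0 1≤0 = 0≉1 (≤-antisym 0≤1 1≤0)

  -- A nonpositive inverse would make the product nonpositive, yet the product is `1#`. Used to
  -- divide by a Lipschitz bound that has been raised above `1#`.
  inverse-nonneg : ∀ x → 1# ≤ x → ∃[ y ] 0# ≤ y × x * y ≈ 1#
  inverse-nonneg x 1≤x
    with inverse x (λ x≈0 → ¬1≤0 (≤-trans 1≤x (≤-reflexive x≈0)))
  ... | y , xy≈1 with total 0# y
  ... | inj₁ 0≤y = y , 0≤y , xy≈1
  ... | inj₂ y≤0 = ⊥-elim (¬1≤0 (≤-trans (≤-reflexive (sym xy≈1))
                     (*-nonpos (≤-trans 0≤1 1≤x) y≤0)))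

  ∣x∣≤c : ∀ {x c} → x ≤ c → - x ≤ c → ∣ x ∣ ≤ c
  ∣x∣≤c {x} x≤c -x≤c with total 0# x
  ... | inj₁ _ = x≤c
  ... | inj₂ _ = -x≤c

  x≤∣x∣ : ∀ x → x ≤ ∣ x ∣
  x≤∣x∣ x with total 0# x
  ... | inj₁ _   = ≤-refl
  ... | inj₂ x≤0 = ≤-trans x≤0 (x≤0⇒0≤-x x≤0)

  -x≤∣x∣ : ∀ x → - x ≤ ∣ x ∣
  -x≤∣x∣ x with total 0# x
  ... | inj₁ 0≤x = ≤-trans (0≤x⇒-x≤0 0≤x) 0≤x
  ... | inj₂ _   = ≤-refl

  0≤∣x∣ : ∀ x → 0# ≤ ∣ x ∣
  0≤∣x∣ x with total 0# x
  ... | inj₁ 0≤x = 0≤x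
  ... | inj₂ x≤0 = x≤0⇒0≤-x x≤0

  -- The case split inside `∣_∣` follows `total`, which need not respect `≈`; the argument therefore
  -- goes through the bounds `x≤∣x∣` and `-x≤∣x∣` and antisymmetry.
  ∣∣-cong : ∀ {x y} → x ≈ y → ∣ x ∣ ≈ ∣ y ∣
  ∣∣-cong x≈y = ≤-antisym (∣∣-mono x≈y) (∣∣-mono (sym x≈y))
    where
    ∣∣-mono : ∀ {x y} → x ≈ y → ∣ x ∣ ≤ ∣ y ∣
    ∣∣-mono {x} {y} x≈y = ∣x∣≤c (≤-trans (≤-reflexive x≈y) (x≤∣x∣ y))
      (≤-trans (≤-reflexive (-‿cong x≈y)) (-x≤∣x∣ y))

  ∣x∣≈0⇒x≈0 : ∀ {x} → ∣ x ∣ ≈ 0# → x ≈ 0#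
  ∣x∣≈0⇒x≈0 {x} ∣x∣≈0 = ≤-antisym (≤-trans (x≤∣x∣ x) (≤-reflexive ∣x∣≈0)) (begin
    0#    ≤⟨ x≤0⇒0≤-x (≤-trans (-x≤∣x∣ x) (≤-reflexive ∣x∣≈0)) ⟩
    - - x ≈⟨ -‿involutive x ⟩
    x     ∎)

  -- Finite sums and products, and the unit interval.

  module _ {A : Set} where
    ∑-cong : ∀ (xs : List A) {f g} → (∀ x → f x ≈ g x) → ∑ xs f ≈ ∑ xs g
    ∑-cong []       f≈g = refl
    ∑-cong (x ∷ xs) f≈g = +-cong (f≈g x) (∑-cong xs f≈g)

    ∑-nonneg : ∀ (xs : List A) {f} → (∀ {x} → x ∈ˡ xs → 0# ≤ f x) → 0# ≤ ∑ xs f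
    ∑-nonneg []       0≤f = ≤-refl
    ∑-nonneg (x ∷ xs) 0≤f = +-nonneg (0≤f (here ≡.refl)) (∑-nonneg xs (0≤f ∘ there))

    ∑-nonpos : ∀ (xs : List A) {f} → (∀ {x} → x ∈ˡ xs → f x ≤ 0#) → ∑ xs f ≤ 0#
    ∑-nonpos []       f≤0 = ≤-refl
    ∑-nonpos (x ∷ xs) f≤0 = ≤-trans
      (+-mono-≤ (f≤0 (here ≡.refl)) (∑-nonpos xs (f≤0 ∘ there)))
      (≤-reflexive (+-identityˡ 0#))

    ∏-zero : ∀ {xs : List A} {f x} → x ∈ˡ xs → f x ≈ 0# → ∏ xs f ≈ 0#
    ∏-zero (here ≡.refl) fx≈0 = trans (*-congʳ fx≈0) (zeroˡ _)
    ∏-zero (there x∈xs)  fx≈0 = trans (*-congˡ (∏-zero x∈xs fx≈0)) (zeroʳ _)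

  UnitInterval : Pred ℝ 0ℓ
  UnitInterval x = 0# ≤ x × x ≤ 1#

  *-unit : ∀ {x y} → x ∈ UnitInterval → y ∈ UnitInterval → x * y ∈ UnitInterval
  *-unit {x} {y} (0≤x , x≤1) (0≤y , y≤1) = *-nonneg 0≤x 0≤y ,
    ≤-trans (*-monoʳ-≤ 0≤y x≤1) (≤-trans (≤-reflexive (*-identityˡ y)) y≤1)

  ∏-unit : ∀ {A : Set} (xs : List A) {f} → (∀ x → f x ∈ UnitInterval) →
           ∏ xs f ∈ UnitInterval
  ∏-unit []       f-unit = 0≤1 , ≤-refl
  ∏-unit (x ∷ xs) f-unit = *-unit (f-unit x) (∏-unit xs f-unit)

  1-unit : ∀ {x} → x ∈ UnitInterval → 1# - x ∈ UnitInterval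
  1-unit (0≤x , x≤1) = x≤y⇒0≤y-x x≤1 ,
    ≤-trans (+-monoʳ-≤ 1# (0≤x⇒-x≤0 0≤x)) (≤-reflexive (+-identityʳ 1#))

  0∈unit : 0# ∈ UnitInterval
  0∈unit = ≤-refl , 0≤1

  1∈unit : 1# ∈ UnitInterval
  1∈unit = 0≤1 , ≤-refl

  -- Approximate equality and Lipschitz functions on the unit interval.

  -- A distance of at most `e`, written as two inequalities so that no absolute value or subtraction
  -- enters the estimates.
  Close : ℝ → ℝ → ℝ → Set
  Close e x y = x ≤ y + e × y ≤ x + e

  close-mono : ∀ {e e′ x y} → e ≤ e′ → Close e x y → Close e′ x y
  close-mono {x = x} {y} e≤e′ (p , q) =
    ≤-trans p (+-monoʳ-≤ y e≤e′) , ≤-trans q (+-monoʳ-≤ x e≤e′)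

  close-+ : ∀ {e e′ x x′ y y′} → Close e x y → Close e′ x′ y′ →
            Close (e + e′) (x + x′) (y + y′)
  close-+ (p , q) (p′ , q′) = half p p′ , half q q′
    where
    half : ∀ {e e′ x x′ y y′} → x ≤ y + e → x′ ≤ y′ + e′ →
           x + x′ ≤ (y + y′) + (e + e′)
    half {e} {e′} {x} {x′} {y} {y′} p p′ = ≤-trans (+-mono-≤ p p′) (≤-reflexive
      (solve 4 (λ y e y′ e′ → (y :+ e) :+ (y′ :+ e′) := (y :+ y′) :+ (e :+ e′))
        refl y e y′ e′))

  close-neg : ∀ {e x y} → Close e x y → Close e (- x) (- y)
  close-neg (p , q) = half q , half p
    where
    half : ∀ {e x y} → y ≤ x + e → - x ≤ - y + e
    half {e} {x} {y} q = +-cancelʳ-≤ y (begin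
      - x + y       ≤⟨ +-monoʳ-≤ (- x) q ⟩
      - x + (x + e) ≈⟨ +-assoc (- x) x e ⟨
      - x + x + e   ≈⟨ +-congʳ (-‿inverseˡ x) ⟩
      0# + e        ≈⟨ +-congʳ (-‿inverseˡ y) ⟨
      - y + y + e   ≈⟨ solve 3 (λ m y e → m :+ y :+ e := m :+ e :+ y) refl (- y) y e ⟩
      - y + e + y   ∎)

  close-scale : ∀ {c e x y} → 0# ≤ c → Close e x y → Close (c * e) (c * x) (c * y)
  close-scale {c} 0≤c (p , q) = half p , half q
    where
    half : ∀ {e x y} → x ≤ y + e → c * x ≤ c * y + c * e
    half {e} {x} {y} p = ≤-trans (*-monoˡ-≤ 0≤c p) (≤-reflexive (distribˡ c y e))

  close-resp : ∀ {e e′ x x′ y y′} → e ≈ e′ → x ≈ x′ → y ≈ y′ →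
               Close e x y → Close e′ x′ y′
  close-resp e≈ x≈ y≈ (p , q) =
    ≤-trans (≤-reflexive (sym x≈)) (≤-trans p (≤-reflexive (+-cong y≈ e≈))) ,
    ≤-trans (≤-reflexive (sym y≈)) (≤-trans q (≤-reflexive (+-cong x≈ e≈)))

  -- Replacing one factor at a time, via `x * y′`, leaves each error multiplied by a number in the
  -- unit interval, so the errors simply add and no cross term appears.
  close-* : ∀ {e e′ x x′ y y′} → 0# ≤ e → 0# ≤ e′ →
            x ∈ UnitInterval → y ∈ UnitInterval → x′ ∈ UnitInterval → y′ ∈ UnitInterval →
            Close e x y → Close e′ x′ y′ → Close (e + e′) (x * x′) (y * y′)
  close-* 0≤e 0≤e′ x∈ y∈ x′∈ y′∈ (p , q) (p′ , q′) =
    half 0≤e 0≤e′ x∈ y′∈ p p′ , half 0≤e 0≤e′ y∈ x′∈ q q′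
    where
    half : ∀ {e e′ x x′ y y′} → 0# ≤ e → 0# ≤ e′ → x ∈ UnitInterval → y′ ∈ UnitInterval →
           x ≤ y + e → x′ ≤ y′ + e′ → x * x′ ≤ y * y′ + (e + e′)
    half {e} {e′} {x} {x′} {y} {y′} 0≤e 0≤e′ (0≤x , x≤1) (0≤y′ , y′≤1) p p′ = begin
      x * x′                     ≤⟨ *-monoˡ-≤ 0≤x p′ ⟩
      x * (y′ + e′)              ≈⟨ distribˡ x y′ e′ ⟩
      x * y′ + x * e′            ≤⟨ +-mono-≤ (*-monoʳ-≤ 0≤y′ p) (*-monoʳ-≤ 0≤e′ x≤1) ⟩
      (y + e) * y′ + 1# * e′     ≈⟨ +-cong (distribʳ y′ y e) (*-identityˡ e′) ⟩
      (y * y′ + e * y′) + e′     ≤⟨ +-monoˡ-≤ e′ (+-monoʳ-≤ (y * y′) (*-monoˡ-≤ 0≤e y′≤1)) ⟩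
      (y * y′ + e * 1#) + e′     ≈⟨ +-congʳ (+-congˡ (*-identityʳ e)) ⟩
      (y * y′ + e) + e′          ≈⟨ +-assoc (y * y′) e e′ ⟩
      y * y′ + (e + e′)          ∎

  -- The displacement is kept as a separate variable d, up to ≈, so that the
  -- estimates are subtraction-free and Lipschitz functions respect ≈.
  record Lipschitz (f : ℝ → ℝ) : Set where
    field
      bound  : ℝ
      0≤L    : 0# ≤ bound
      close  : ∀ {x y d} → x ∈ UnitInterval → y ∈ UnitInterval → 0# ≤ d → y ≈ x + d →
               Close (bound * d) (f x) (f y)
  open Lipschitz

  lipschitz-const : ∀ c → Lipschitz (const c)
  lipschitz-const c = record
    { bound = 0#
    ; 0≤L   = ≤-refl
    ; close = λ {_} {_} {d} _ _ _ _ → close-resp (sym (zeroˡ d)) refl refl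
                (≤-reflexive (sym (+-identityʳ c)) , ≤-reflexive (sym (+-identityʳ c)))
    }

  lipschitz-id : Lipschitz (λ x → x)
  lipschitz-id = record
    { bound = 1#
    ; 0≤L   = 0≤1
    ; close = λ {x} {y} {d} _ _ 0≤d y≈x+d → close-resp (sym (*-identityˡ d)) refl refl
                ( ≤-trans (x≤x+y 0≤d) (≤-trans (≤-reflexive (sym y≈x+d)) (x≤x+y 0≤d))
                , ≤-reflexive y≈x+d )
    }

  module _ {f g} (F : Lipschitz f) (G : Lipschitz g) where
    lipschitz-+ : Lipschitz (λ x → f x + g x)
    lipschitz-+ = record
      { bound = bound F + bound G
      ; 0≤L   = +-nonneg (0≤L F) (0≤L G)
      ; close = λ {_} {_} {d} x∈ y∈ 0≤d y≈ →
          close-resp (sym (distribʳ d (bound F) (bound G))) refl refl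
            (close-+ (close F x∈ y∈ 0≤d y≈) (close G x∈ y∈ 0≤d y≈))
      }

    lipschitz-* : (∀ {x} → x ∈ UnitInterval → f x ∈ UnitInterval) →
                  (∀ {x} → x ∈ UnitInterval → g x ∈ UnitInterval) →
                  Lipschitz (λ x → f x * g x)
    lipschitz-* f-unit g-unit = record
      { bound = bound F + bound G
      ; 0≤L   = +-nonneg (0≤L F) (0≤L G)
      ; close = λ {_} {_} {d} x∈ y∈ 0≤d y≈ →
          close-resp (sym (distribʳ d (bound F) (bound G))) refl refl
            (close-* (*-nonneg (0≤L F) 0≤d) (*-nonneg (0≤L G) 0≤d)
              (f-unit x∈) (f-unit y∈) (g-unit x∈) (g-unit y∈)
              (close F x∈ y∈ 0≤d y≈) (close G x∈ y∈ 0≤d y≈))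
      }

  lipschitz-neg : ∀ {f} → Lipschitz f → Lipschitz (λ x → - f x)
  lipschitz-neg F = record
    { bound = bound F
    ; 0≤L   = 0≤L F
    ; close = λ x∈ y∈ 0≤d y≈ → close-neg (close F x∈ y∈ 0≤d y≈)
    }

  lipschitz-resp : ∀ {f g} → (∀ x → f x ≈ g x) → Lipschitz f → Lipschitz g
  lipschitz-resp f≈g F = record
    { bound = bound F
    ; 0≤L   = 0≤L F
    ; close = λ {x} {y} x∈ y∈ 0≤d y≈ →
        close-resp refl (f≈g x) (f≈g y) (close F x∈ y∈ 0≤d y≈)
    }

  lipschitz-scale-nonneg : ∀ {c f} → 0# ≤ c → Lipschitz f → Lipschitz (λ x → c * f x)
  lipschitz-scale-nonneg {c} 0≤c F = record
    { bound = c * bound F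
    ; 0≤L   = *-nonneg 0≤c (0≤L F)
    ; close = λ {_} {_} {d} x∈ y∈ 0≤d y≈ →
        close-resp (sym (*-assoc c (bound F) d)) refl refl
          (close-scale 0≤c (close F x∈ y∈ 0≤d y≈))
    }

  -- `close-scale` needs a nonnegative scalar, so a negative `c` is handled as the negation of
  -- scaling by `- c`. Negative scalars do arise, from lost edges.
  lipschitz-scale : ∀ c {f} → Lipschitz f → Lipschitz (λ x → c * f x)
  lipschitz-scale c {f} F with total 0# c
  ... | inj₁ 0≤c = lipschitz-scale-nonneg 0≤c F
  ... | inj₂ c≤0 = lipschitz-resp
    (λ x → trans (-‿distribˡ-* (- c) (f x)) (*-congʳ (-‿involutive c)))
    (lipschitz-neg (lipschitz-scale-nonneg (x≤0⇒0≤-x c≤0) F))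

  lipschitz-∑ : ∀ {A : Set} (xs : List A) {f : A → ℝ → ℝ} → (∀ a → Lipschitz (f a)) →
                Lipschitz (λ x → ∑ xs (λ a → f a x))
  lipschitz-∑ []       F = lipschitz-const 0#
  lipschitz-∑ (a ∷ xs) F = lipschitz-+ (F a) (lipschitz-∑ xs F)

  lipschitz-∏ : ∀ {A : Set} (xs : List A) {f : A → ℝ → ℝ} → (∀ a → Lipschitz (f a)) →
                (∀ a {x} → x ∈ UnitInterval → f a x ∈ UnitInterval) →
                Lipschitz (λ x → ∏ xs (λ a → f a x))
  lipschitz-∏ []       F f-unit = lipschitz-const 1#
  lipschitz-∏ (a ∷ xs) F f-unit = lipschitz-* (F a) (lipschitz-∏ xs F f-unit)
    (f-unit a) (λ x∈ → ∏-unit xs (λ a → f-unit a x∈))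

  -- The intermediate value theorem for Lipschitz functions.

  -- The zero is the supremum `s` of the points of the unit interval where `f` is nonnegative. A
  -- nonzero value at `s` would keep its sign over a definite distance, which contradicts either the
  -- leastness of `s`, its being an upper bound, or the sign of `f 1#`.
  intermediateZero : ∀ {f} → Lipschitz f → 0# ≤ f 0# → f 1# ≤ 0# →
                     ∃[ x ] x ∈ UnitInterval × f x ≈ 0#
  intermediateZero {f} F 0≤f0 f1≤0 with complete
    (λ x → Lift (lsuc 0ℓ) (x ∈ UnitInterval × 0# ≤ f x))
    (0# , lift (0∈unit , 0≤f0)) (1# , λ _ (lift ((_ , x≤1) , _)) → x≤1)
  ... | s , s-upper , s-least = s , s∈ , ≤-antisym fs≤0 0≤fs
    where
    s∈ : s ∈ UnitInterval
    s∈ = s-upper 0# (lift (0∈unit , 0≤f0)) ,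
         s-least 1# (λ _ (lift ((_ , x≤1) , _)) → x≤1)

    -- Adding `1#` makes the Lipschitz constant invertible even when the given bound is zero.
    L : ℝ
    L = 1# + bound F

    1≤L : 1# ≤ L
    1≤L = x≤x+y (0≤L F)

    close-L : ∀ {x y d} → x ∈ UnitInterval → y ∈ UnitInterval → 0# ≤ d → y ≈ x + d →
              Close (L * d) (f x) (f y)
    close-L {d = d} x∈ y∈ 0≤d y≈ = close-mono
      (*-monoʳ-≤ 0≤d (≤-trans (x≤x+y 0≤1) (≤-reflexive (+-comm (bound F) 1#))))
      (close F x∈ y∈ 0≤d y≈)

    -- f changes by at most e over a distance e / L.
    step : ℝ → ℝ
    step e = proj₁ (inverse-nonneg L 1≤L) * e

    step-nonneg : ∀ {e} → 0# ≤ e → 0# ≤ step e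
    step-nonneg = *-nonneg (proj₁ (proj₂ (inverse-nonneg L 1≤L)))

    L*step : ∀ e → L * step e ≈ e
    L*step e = trans (sym (*-assoc L _ e))
      (trans (*-congʳ (proj₂ (proj₂ (inverse-nonneg L 1≤L)))) (*-identityˡ e))

    -- Cancelling `x` gives `step e ≤ 0#`, and multiplying by `L` recovers `e`. Both halves of the
    -- supremum argument end with this.
    step-nonpos⇒ : ∀ {x e} → x + step e ≤ x → e ≤ 0#
    step-nonpos⇒ {x} {e} x+h≤x = begin
      e          ≈⟨ L*step e ⟨
      L * step e ≤⟨ *-nonpos (≤-trans 0≤1 1≤L) (+-cancelʳ-≤ x (begin
        step e + x ≈⟨ +-comm (step e) x ⟩
        x + step e ≤⟨ x+h≤x ⟩
        x          ≈⟨ +-identityˡ x ⟨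
        0# + x     ∎)) ⟩
      0#         ∎

    e≤Ld⇒step≤d : ∀ {e d} → e ≤ L * d → step e ≤ d
    e≤Ld⇒step≤d {e} {d} e≤Ld with inverse-nonneg L 1≤L
    ... | i , 0≤i , Li≈1 = begin
      i * e       ≤⟨ *-monoˡ-≤ 0≤i e≤Ld ⟩
      i * (L * d) ≈⟨ solve 3 (λ i L d → i :* (L :* d) := L :* i :* d) refl i L d ⟩
      L * i * d   ≈⟨ *-congʳ Li≈1 ⟩
      1# * d      ≈⟨ *-identityˡ d ⟩
      d           ∎

    0≤fs : 0# ≤ f s
    0≤fs with total 0# (f s)
    ... | inj₁ 0≤fs = 0≤fs
    ... | inj₂ fs≤0 = begin
      0#      ≤⟨ x≤0⇒0≤-x (step-nonpos⇒ (begin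
        s + h     ≤⟨ +-monoˡ-≤ h (s-least (s - h) s-h-upper) ⟩
        s - h + h ≈⟨ x-y+y≈x s h ⟩
        s         ∎)) ⟩
      - - f s ≈⟨ -‿involutive (f s) ⟩
      f s     ∎
      where
      -- To rise from `f s` to a nonnegative value, `f` needs a distance of at least `h`. So all
      -- points of the set lie at least `h` to the left of `s`, and `s - h` is already an upper
      -- bound.
      h : ℝ
      h = step (- f s)
      s-h-upper : IsUpperBound (λ x → Lift (lsuc 0ℓ) (x ∈ UnitInterval × 0# ≤ f x)) (s - h)
      s-h-upper x x∈S@(lift (x∈ , 0≤fx)) = +-cancelʳ-≤ h (begin
        x + h       ≤⟨ +-monoʳ-≤ x (e≤Ld⇒step≤d (+-cancelʳ-≤ (f s) (begin
          - f s + f s         ≈⟨ -‿inverseˡ (f s) ⟩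
          0#                  ≤⟨ 0≤fx ⟩
          f x                 ≤⟨ proj₁ (close-L x∈ s∈ (x≤y⇒0≤y-x (s-upper x x∈S))
                                   (sym (x+[y-x]≈y x s))) ⟩
          f s + L * (s - x)   ≈⟨ +-comm (f s) _ ⟩
          L * (s - x) + f s   ∎))) ⟩
        x + (s - x) ≈⟨ x+[y-x]≈y x s ⟩
        s           ≈⟨ x-y+y≈x s h ⟨
        s - h + h   ∎)

    fs≤0 : f s ≤ 0#
    fs≤0 with total 0# (f s)
    ... | inj₂ fs≤0 = fs≤0
    ... | inj₁ 0≤fs with total (s + step (f s)) 1#
    -- `f` drops by at most `f s` on the way to `s + step (f s)`, so this point still belongs to the
    -- set and cannot exceed `s`.
    ... | inj₁ s+h≤1 = step-nonpos⇒ (s-upper (s + step (f s)) (lift (s+h∈ , 0≤f[s+h])))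
      where
      s+h∈ : s + step (f s) ∈ UnitInterval
      s+h∈ = +-nonneg (proj₁ s∈) (step-nonneg 0≤fs) , s+h≤1
      0≤f[s+h] : 0# ≤ f (s + step (f s))
      0≤f[s+h] = +-cancelʳ-≤ (f s) (begin
        0# + f s                                ≈⟨ +-identityˡ (f s) ⟩
        f s                                     ≤⟨ proj₁ (close-L s∈ s+h∈ (step-nonneg 0≤fs) refl) ⟩
        f (s + step (f s)) + L * step (f s)     ≈⟨ +-congˡ (L*step (f s)) ⟩
        f (s + step (f s)) + f s                ∎)
    -- Here `1#` is within one step of `s`, so `f 1#` is nonnegative and `1#` lies in the set, which
    -- forces `s ≈ 1#`. The estimate with displacement `0#` then carries `f s` to `f 1#`.
    ... | inj₂ 1≤s+h = begin
      f s           ≤⟨ proj₁ (close-L s∈ 1∈unit ≤-refl 1≈s+0) ⟩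
      f 1# + L * 0# ≈⟨ +-congˡ (zeroʳ L) ⟩
      f 1# + 0#     ≈⟨ +-identityʳ (f 1#) ⟩
      f 1#          ≤⟨ f1≤0 ⟩
      0#            ∎
      where
      1-s≤h : 1# - s ≤ step (f s)
      1-s≤h = +-cancelʳ-≤ s (begin
        1# - s + s     ≈⟨ x-y+y≈x 1# s ⟩
        1#             ≤⟨ 1≤s+h ⟩
        s + step (f s) ≈⟨ +-comm s _ ⟩
        step (f s) + s ∎)
      0≤f1 : 0# ≤ f 1#
      0≤f1 = +-cancelʳ-≤ (f s) (begin
        0# + f s                ≈⟨ +-identityˡ (f s) ⟩
        f s                     ≤⟨ proj₁ (close-L s∈ 1∈unit (x≤y⇒0≤y-x (proj₂ s∈))
                                     (sym (x+[y-x]≈y s 1#))) ⟩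
        f 1# + L * (1# - s)     ≤⟨ +-monoʳ-≤ (f 1#) (*-monoˡ-≤ (≤-trans 0≤1 1≤L) 1-s≤h) ⟩
        f 1# + L * step (f s)   ≈⟨ +-congˡ (L*step (f s)) ⟩
        f 1# + f s              ∎)
      1≈s+0 : 1# ≈ s + 0#
      1≈s+0 = trans (≤-antisym (s-upper 1# (lift (1∈unit , 0≤f1))) (proj₂ s∈))
                (sym (+-identityʳ s))

module ConstantGraphons (em : ∀ {ℓ} → ExcludedMiddle ℓ) (𝔽 : CompleteOrderedField)
                        (P : ProbabilitySpace 𝔽) where
  open FlipProcess em 𝔽 P hiding (zero)
  open OrderedFieldProperties 𝔽
  open RingProperties ring using (-0#≈0#; x∙y⁻¹≈ε⇒x≈y; x≈y⇒x∙y⁻¹≈ε)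
  open SemiringSum semiring using (*-distribˡ-sum)
  open PartialOrderReasoning poset

  -- Finite additivity of the measure.

  hasSum-eventually-const : ∀ {a s c} N → (∀ n → sum {N ℕ.+ n} (a ∘ toℕ) ≈ c) →
                            HasSum a s → c ≈ s
  hasSum-eventually-const {a} {s} {c} N sum≈c hasSum with em {P = c ≈ s}
  ... | yes c≈s = c≈s
  -- With tolerance `∣ c - s ∣`, a partial sum of length `N + M` is both equal to `c` and strictly
  -- closer to `s` than `c` is.
  ... | no c≉s with hasSum ∣ c - s ∣
    (0≤∣x∣ _ , λ 0≈ → c≉s (x∙y⁻¹≈ε⇒x≈y c s (∣x∣≈0⇒x≈0 (sym 0≈))))
  ... | M , tail<ε = ⊥-elim (proj₂ (tail<ε (N ℕ.+ M) (m≤n+m M N))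
                                   (∣∣-cong (+-congʳ (sum≈c M))))

  -- Pads a finite family to a sequence; with `∅` as padding, countable additivity applies to finite
  -- partitions.
  extend : ∀ {a} {A : Set a} {n} → (Fin n → A) → A → ℕ → A
  extend {n = zero}  f d _       = d
  extend {n = suc n} f d zero    = f zero
  extend {n = suc n} f d (suc i) = extend (f ∘ suc) d i

  sum-extend : ∀ {n} (f : Fin n → Pred Ω 0ℓ) m →
               sum {n ℕ.+ m} (π ∘ extend f ∅ ∘ toℕ) ≈ sum (π ∘ f)
  sum-extend {suc n} f m       = +-congˡ (sum-extend (f ∘ suc) m)
  sum-extend {zero}  f zero    = refl
  sum-extend {zero}  f (suc m) = trans (+-cong π-∅ (sum-extend f m)) (+-identityˡ 0#)

  measurable-∅ : Measurable ∅
  measurable-∅ = measurable-resp ((λ ∉U → ∉U tt) , λ ()) (measurable-∁ measurable-U)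

  extend-measurable : ∀ {n} (f : Fin n → Pred Ω 0ℓ) → (∀ i → Measurable (f i)) →
                      ∀ i → Measurable (extend f ∅ i)
  extend-measurable {zero}  f f-meas i       = measurable-∅
  extend-measurable {suc n} f f-meas zero    = f-meas zero
  extend-measurable {suc n} f f-meas (suc i) = extend-measurable (f ∘ suc) (f-meas ∘ suc) i

  extend-toℕ : ∀ {n} (f : Fin n → Pred Ω 0ℓ) i → extend f ∅ (toℕ i) ≡ f i
  extend-toℕ f zero    = ≡.refl
  extend-toℕ f (suc i) = extend-toℕ (f ∘ suc) i

  -- The padding sets have no points, so an inhabited entry comes from the original family. This
  -- transfers disjointness to the padded sequence.
  extend-fromℕ : ∀ {n} (f : Fin n → Pred Ω 0ℓ) i {ω} → ω ∈ extend f ∅ i →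
                 ∃[ j ] toℕ j ≡ i × ω ∈ f j
  extend-fromℕ {suc n} f zero    ω∈ = zero , ≡.refl , ω∈
  extend-fromℕ {suc n} f (suc i) ω∈ with extend-fromℕ (f ∘ suc) i ω∈
  ... | j , ≡.refl , ω∈fj = suc j , ≡.refl , ω∈fj

  sum-π-partition : ∀ {n} (A : Fin n → Pred Ω 0ℓ) → (∀ i → Measurable (A i)) →
                    (∀ i j → i ≢ j → A i ⊥ A j) → (∀ ω → ∃[ i ] ω ∈ A i) →
                    sum (π ∘ A) ≈ 1#
  sum-π-partition {n} A A-meas A-disjoint A-covers = trans
    (hasSum-eventually-const {π ∘ extend A ∅} n (sum-extend A)
      (π-⋃ (extend A ∅) (extend-measurable A A-meas) extend-disjoint))
    (trans (sym (π-cong measurable-U ((λ {ω} _ → covered ω) , λ _ → tt))) π-U)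
    where
    extend-disjoint : ∀ i j → i ≢ j → extend A ∅ i ⊥ extend A ∅ j
    extend-disjoint i j i≢j (ω∈i , ω∈j)
      with extend-fromℕ A i ω∈i | extend-fromℕ A j ω∈j
    ... | i′ , ≡.refl , ω∈Ai | j′ , ≡.refl , ω∈Aj =
      A-disjoint i′ j′ (i≢j ∘ ≡.cong toℕ) (ω∈Ai , ω∈Aj)
    covered : ∀ ω → ω ∈ ⋃ ℕ (extend A ∅)
    covered ω with A-covers ω
    ... | i , ω∈Ai = toℕ i , ≡.subst (ω ∈_) (≡.sym (extend-toℕ A i)) ω∈Ai

  sum-mono : ∀ {n} {f g : Fin n → ℝ} → (∀ i → f i ≤ g i) → sum f ≤ sum g
  sum-mono {zero}  f≤g = ≤-refl
  sum-mono {suc n} f≤g = +-mono-≤ (f≤g zero) (sum-mono (f≤g ∘ suc))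

  -- Integrals of constant functions.

  sup-maximum : ∀ {S m} → S m → IsUpperBound S m → sup S ≈ m
  sup-maximum {S} {m} m∈S m-upper with em {P = ∃ S × ∃ (IsUpperBound S)}
  ... | no ¬bounded    = ⊥-elim (¬bounded ((m , m∈S) , (m , m-upper)))
  ... | yes (ne , bd) with complete S ne bd
  ... | s , s-upper , s-least = ≤-antisym (s-least m m-upper) (s-upper m m∈S)

  -- The one-block partition attains `c`. Any other lower sum is at most `c` times the total mass of
  -- its parts, which is `1#` by `sum-π-partition`.
  ∫-const : ∀ {f c} → (∀ ω → f ω ≈ c) → ∫ f ≈ c
  ∫-const {f} {c} f≈c = sup-maximum c∈ c-upper
    where
    c∈ : LowerSum f c
    c∈ = record
      { size       = 1
      ; part       = λ _ → U
      ; measurable = λ _ → measurable-U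
      ; disjoint   = λ { zero zero 0≢0 _ → 0≢0 ≡.refl }
      ; covering   = λ _ → zero , tt
      ; value      = λ _ → c
      ; below      = λ _ ω _ → ≤-reflexive (sym (f≈c ω))
      ; total-sum  = sym (trans (+-identityʳ _) (trans (*-congˡ π-U) (*-identityʳ c)))
      }
    c-upper : IsUpperBound (LowerSum f) c
    c-upper r r∈ = begin
      r                                ≈⟨ total-sum ⟩
      sum (λ i → value i * π (part i)) ≤⟨ sum-mono part≤ ⟩
      sum (λ i → c * π (part i))       ≈⟨ *-distribˡ-sum c (π ∘ part) ⟨
      c * sum (π ∘ part)               ≈⟨ *-congˡ (sum-π-partition part measurable disjoint covering) ⟩
      c * 1#                           ≈⟨ *-identityʳ c ⟩
      c                                ∎
      where
      open LowerSum r∈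
      part≤ : ∀ i → value i * π (part i) ≤ c * π (part i)
      -- `below` bounds the value only where the part has a point. On an empty part the value is
      -- arbitrary, but the measure is zero.
      part≤ i with em {P = ∃ (part i)}
      ... | yes (ω , ω∈) = *-monoʳ-≤ (π-nonneg (measurable i))
              (≤-trans (below i ω ω∈) (≤-reflexive (f≈c ω)))
      ... | no empty = ≤-reflexive (trans (null (value i)) (sym (null c)))
        where
        null : ∀ x → x * π (part i) ≈ 0#
        null x = trans (*-congˡ (trans
          (π-cong (measurable i) ((λ ω∈ → empty (_ , ω∈)) , λ ())) π-∅)) (zeroʳ x)

  ∫over-const : ∀ {k} (is : List (Fin k)) {g c} → (∀ z → g z ≈ c) → ∀ x → ∫over is g x ≈ c
  ∫over-const []       g≈c x = g≈c x
  ∫over-const (i ∷ is) g≈c x = ∫-const (λ ω → ∫over-const is g≈c _)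

  -- Statements holding everywhere, and constant kernels.

  everywhere⇒ae : ∀ {Q : Ω → Ω → Set} → (∀ x y → Q x y) → AlmostEverywhere Q
  everywhere⇒ae q =
    -- The exceptional set is empty, written as the complement of the full rectangle so that its
    -- measurability is immediate.
    ∁ (U ⟨×⟩ U) , complement (rectangle measurable-U measurable-U) ,
    ∫-const (λ x → ∫-const (λ y → null x y)) , λ x y _ → q x y
    where
    null : ∀ x y → 𝟙 (∁ (U ⟨×⟩ U)) (x , y) ≈ 0#
    null x y with em {P = (x , y) ∈ ∁ (U ⟨×⟩ U)}
    ... | yes ∉UU = ⊥-elim (∉UU (tt , tt))
    ... | no _    = refl

  constant : ℝ → Kernel
  constant p = record
    { fun        = λ _ _ → p
    ; measurable = super-level
    ; bounded    = ∣ p ∣ , λ _ _ → ≤-refl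
    ; symmetric  = everywhere⇒ae λ _ _ → refl
    }
    where
    super-level : ∀ c → Measurable² (λ _ → c < p)
    super-level c with em {P = c < p}
    ... | yes c<p = resp ((λ _ → c<p) , λ _ → tt , tt) (rectangle measurable-U measurable-U)
    ... | no c≮p  = resp ((λ ∉UU → ⊥-elim (∉UU (tt , tt))) , λ c<p → ⊥-elim (c≮p c<p))
                      (complement (rectangle measurable-U measurable-U))

  -- Densities of labelled graphs in a constant graphon.

  -- The probability that the Erdős-Rényi random graph on `k` labelled vertices with edge
  -- probability `p` equals `F`.
  density : ∀ {k} → Graph k → ℝ → ℝ
  density F p = ∏ (edges F) (const p) * ∏ (nonEdges F) (const (1# - p))

  density-unit : ∀ {k} (F : Graph k) {p} → p ∈ UnitInterval → density F p ∈ UnitInterval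
  density-unit F p∈ =
    *-unit (∏-unit (edges F) (const p∈)) (∏-unit (nonEdges F) (const (1-unit p∈)))

  density-at-0 : ∀ {k} (F : Graph k) {a b} → a ≢ b → edge F a b ≡ true → density F 0# ≈ 0#
  density-at-0 F a≢b ab =
    trans (*-congʳ (∏-zero (proj₂ (edges-nonempty F a≢b ab)) refl)) (zeroˡ _)

  density-at-1 : ∀ {k} (F : Graph k) {a b} → a ≢ b → edge F a b ≡ false → density F 1# ≈ 0#
  density-at-1 F a≢b ab = trans
    (*-congˡ (∏-zero (proj₂ (nonEdges-nonempty F a≢b ab)) (-‿inverseʳ 1#))) (zeroʳ _)

  lipschitz-density : ∀ {k} (F : Graph k) → Lipschitz (density F)
  lipschitz-density F = lipschitz-*
    (lipschitz-∏ (edges F) (const lipschitz-id) (const (λ p∈ → p∈)))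
    (lipschitz-∏ (nonEdges F) (const lipschitz-1-) (const 1-unit))
    (λ p∈ → ∏-unit (edges F) (const p∈))
    (λ p∈ → ∏-unit (nonEdges F) (const (1-unit p∈)))
    where
    lipschitz-1- : Lipschitz (λ p → 1# - p)
    lipschitz-1- = lipschitz-+ (lipschitz-const 1#) (lipschitz-neg lipschitz-id)

  -- The integrand does not depend on the sampled points, so every iterated integral returns it
  -- unchanged.
  T^-constant : ∀ {k} (F : Graph k) a b p x y → T^ F a b (constant p) x y ≈ density F p
  T^-constant {k} F a b p x y =
    ∫over-const (filter (λ i → ¬? (i ≟ a) ×-dec ¬? (i ≟ b)) (allFin k)) (λ _ → refl) _

  -- Velocity on constant graphons and stationary trajectories.

  𝕀-nonneg : ∀ b → 0# ≤ 𝕀 b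
  𝕀-nonneg true  = 0≤1
  𝕀-nonneg false = ≤-refl

  -- `e` is the state of a pair before the replacement and `e′` the state after it: a gained edge
  -- counts `1#`, a lost one `- 1#`.
  flipSign : Bool → Bool → ℝ
  flipSign e e′ = 𝕀 (e′ ∧ not e) - 𝕀 (e ∧ not e′)

  gain-nonneg : ∀ e′ → 0# ≤ flipSign false e′
  gain-nonneg e′ = +-nonneg (𝕀-nonneg _) (≤-reflexive (sym -0#≈0#))

  loss-nonpos : ∀ e′ → flipSign true e′ ≤ 0#
  loss-nonpos true  = ≤-reflexive (-‿inverseʳ 0#)
  loss-nonpos false = ≤-trans (≤-reflexive (+-identityˡ _)) (0≤x⇒-x≤0 0≤1)

  module _ {k} (R : Rule k) where
    velocity : ℝ → ℝ
    velocity p = ∑ (allGraphs k) λ F → ∑ (allGraphs k) λ H → prob R F H *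
      ∑ (orderedPairs k) λ (a , b) → density F p * flipSign (edge F a b) (edge H a b)

    𝔙-constant : ∀ p x y → 𝔙 R (constant p) x y ≈ velocity p
    𝔙-constant p x y =
      ∑-cong (allGraphs k) λ F → ∑-cong (allGraphs k) λ H → *-congˡ
        (∑-cong (orderedPairs k) λ (a , b) → *-congʳ (T^-constant F a b p x y))

    lipschitz-velocity : Lipschitz velocity
    lipschitz-velocity =
      lipschitz-∑ (allGraphs k) λ F → lipschitz-∑ (allGraphs k) λ H →
        lipschitz-scale (prob R F H) (lipschitz-∑ (orderedPairs k) λ (a , b) →
          -- The scalar must stand on the left for `lipschitz-scale`, whereas `velocity` has the
          -- sign on the right.
          lipschitz-resp (λ p → *-comm _ (density F p))
            (lipschitz-scale (flipSign (edge F a b) (edge H a b)) (lipschitz-density F)))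

    velocity-at-0 : 0# ≤ velocity 0#
    velocity-at-0 = ∑-nonneg (allGraphs k) λ {F} _ → ∑-nonneg (allGraphs k) λ {H} _ →
      *-nonneg (Rule.nonneg R F H) (∑-nonneg (orderedPairs k) λ {ab} ab∈ →
        term F H (∈-orderedPairs⁻ ab∈))
      where
      term : ∀ F H {a b : Fin k} → a ≢ b →
             0# ≤ density F 0# * flipSign (edge F a b) (edge H a b)
      -- If `ab` is an edge of `F`, the density at `0#` vanishes; otherwise the pair can only be
      -- gained.
      term F H {a} {b} a≢b with edge F a b in ab
      ... | true  = ≤-reflexive (sym (trans (*-congʳ (density-at-0 F a≢b ab)) (zeroˡ _)))
      ... | false = *-nonneg (proj₁ (density-unit F 0∈unit)) (gain-nonneg (edge H a b))

    velocity-at-1 : velocity 1# ≤ 0#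
    velocity-at-1 = ∑-nonpos (allGraphs k) λ {F} _ → ∑-nonpos (allGraphs k) λ {H} _ →
      *-nonpos (Rule.nonneg R F H) (∑-nonpos (orderedPairs k) λ {ab} ab∈ →
        term F H (∈-orderedPairs⁻ ab∈))
      where
      term : ∀ F H {a b : Fin k} → a ≢ b →
             density F 1# * flipSign (edge F a b) (edge H a b) ≤ 0#
      -- Dually, a non-edge kills the density at `1#`, and an edge can only be lost.
      term F H {a} {b} a≢b with edge F a b in ab
      ... | false = ≤-reflexive (trans (*-congʳ (density-at-1 F a≢b ab)) (zeroˡ _))
      ... | true  = *-nonpos (proj₁ (density-unit F 1∈unit)) (loss-nonpos (edge H a b))

    stationary : ∀ W → (∀ x y → 𝔙 R W x y ≈ 0#) → IsTrajectory R W U (const W)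
    stationary W 𝔙W≈0 = record
      { isSolution = record
        { zero∈D   = tt
        ; convex   = λ _ _ _ _ → tt
        ; open-D   = λ _ _ → 1# , (0≤1 , 0≉1) , λ _ _ → tt
        ; cong     = λ _ _ _ → everywhere⇒ae λ _ _ → refl
        ; initial  = everywhere⇒ae λ _ _ → refl
        -- The increment minus its linear part is exactly zero for every `h`, so any radius works;
        -- `1#` is chosen.
        ; equation = λ t _ ε (0≤ε , _) → 1# , (0≤1 , 0≉1) , λ h _ _ →
            everywhere⇒ae λ x y → ≤-trans
              (≤-reflexive (∣∣-cong (increment≈0 h x y)))
              (∣x∣≤c (0≤ε*∣h∣ 0≤ε) (≤-trans (≤-reflexive -0#≈0#) (0≤ε*∣h∣ 0≤ε)))
        }
      -- The domain is already the whole line, so no solution can extend it.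
      ; maximal = λ _ _ _ _ _ _ → tt
      }
      where
      0≤ε*∣h∣ : ∀ {ε h} → 0# ≤ ε → 0# ≤ ε * ∣ h ∣
      0≤ε*∣h∣ {h = h} 0≤ε = *-nonneg 0≤ε (0≤∣x∣ h)
      increment≈0 : ∀ h x y → fun W x y - fun W x y - h * 𝔙 R W x y ≈ 0#
      increment≈0 h x y = x≈y⇒x∙y⁻¹≈ε
        (trans (-‿inverseʳ _) (sym (trans (*-congˡ (𝔙W≈0 x y)) (zeroʳ h))))

    constantFixedPoint : ∃[ W ] IsGraphon W × 𝔙 R W ≈ᵃᵉ (λ _ _ → 0#) × IsFixedPoint R W
    constantFixedPoint
      with intermediateZero lipschitz-velocity velocity-at-0 velocity-at-1
    ... | p , p∈ , vp≈0 =
      constant p , graphon , everywhere⇒ae 𝔙≈0 ,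
      graphon , const (constant p) , stationary (constant p) 𝔙≈0 ,
      λ _ → everywhere⇒ae λ _ _ → refl
      where
      graphon : IsGraphon (constant p)
      graphon = everywhere⇒ae λ _ _ → p∈
      𝔙≈0 : ∀ x y → 𝔙 R (constant p) x y ≈ 0#
      𝔙≈0 x y = trans (𝔙-constant p x y) vp≈0

proposition6p10 : (em : ∀ {ℓ} → ExcludedMiddle ℓ) (𝔽 : CompleteOrderedField) (P : ProbabilitySpace 𝔽) →
    let open FlipProcess em 𝔽 P in
    Atomless → Separable →
    (k : ℕ) (R : Rule k) →
    ∃[ W ] IsGraphon W × 𝔙 R W ≈ᵃᵉ (λ _ _ → 0#) × IsFixedPoint R W
proposition6p10 em 𝔽 P _ _ k R = ConstantGraphons.constantFixedPoint em 𝔽 P R
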